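{- Let $n\ge 1$ and $m\ge 1$ be any positive integers with $m\le n$. Then for any prime $p$, $$\binom{np}{mp}\equiv\binom{n}{m}\pmod{p}.$$ -}

module Defs where

open import Data.Integer.Base using (ℤ; _-_)
open import Data.Integer.Divisibility.Signed using (_∣_)

infix 4 _≡_[mod_]

_≡_[mod_] : ℤ → ℤ → ℤ → Set
a ≡ b [mod k ] = k ∣ a - b

{-# OPTIONS --safe #-}

-- Since p ∣ C(p , k) for 0 < k < p, induction on a by Pascal's rule gives
-- C(a + p , k + p) ≡ C(a , k) + C(a , k + p) modulo p, which is (1 + X)ᵖ ≡ 1 + Xᵖ
-- read off in coefficients. On multiples of p this is again Pascal's rule, so
-- C(n p , m p) and C(n , m) satisfy the same recurrence with the same boundary values.
module Submission where

open import Defs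
open import Data.Nat.Base using (ℕ; zero; suc; _+_; _*_; _≤_; _<_; s<s; z<s)
open import Data.Nat.Combinatorics
  using (_C_; nCn≡1; k>n⇒nCk≡0; nCk+nC[k+1]≡[n+1]C[k+1])
open import Data.Nat.Divisibility using (_∣_; m∣m*n; >⇒∤)
open import Data.Nat.Primality using (Prime; euclidsLemma; ¬prime[0])
open import Data.Nat.Properties
  using (+-comm; *-zeroʳ; n<1+n; m<n+m; <⇒≤)
open import Data.Nat.Tactic.RingSolver using (solve-∀)
open import Data.Integer.Base using (+_; _-_)
import Data.Integer.Base as ℤ
import Data.Nat.Base as ℕ
import Data.Integer.Divisibility.Signed as ℤ
import Data.Integer.Properties as ℤ
import Data.Integer.Tactic.RingSolver as ℤ-Solver
open import Data.Sum.Base using (inj₁; inj₂)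
open import Relation.Binary.PropositionalEquality
  using (_≡_; refl; sym; trans; cong; cong₂; subst; subst₂; module ≡-Reasoning)
open import Relation.Nullary.Negation using (contradiction)

≡⇒≡-mod : ∀ {a b} k → a ≡ b → + a ≡ + b [mod k ]
≡⇒≡-mod {a} k refl =
  ℤ.divides ℤ.0ℤ (trans (ℤ.+-inverseʳ (+ a)) (sym (ℤ.*-zeroˡ k)))

≡-mod-trans : ∀ {k} i j l → i ≡ j [mod k ] → j ≡ l [mod k ] → i ≡ l [mod k ]
≡-mod-trans {k} i j l i≡j j≡l =
  subst (k ℤ.∣_) (telescope i j l) (ℤ.∣m∣n⇒∣m+n i≡j j≡l)
  where
  telescope : ∀ i j l → (i - j) ℤ.+ (j - l) ≡ i - l
  telescope = ℤ-Solver.solve-∀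

+-cong-mod : ∀ {k} a b c d → + a ≡ + b [mod k ] → + c ≡ + d [mod k ] →
             + (a + c) ≡ + (b + d) [mod k ]
+-cong-mod {k} a b c d a≡b c≡d =
  subst (k ℤ.∣_) (interchange (+ a) (+ b) (+ c) (+ d)) (ℤ.∣m∣n⇒∣m+n a≡b c≡d)
  where
  interchange : ∀ i j l m → (i - j) ℤ.+ (l - m) ≡ (i ℤ.+ l) - (j ℤ.+ m)
  interchange = ℤ-Solver.solve-∀

∣⇒≡0-mod : ∀ {k a} → k ∣ a → + a ≡ + 0 [mod + k ]
∣⇒≡0-mod {k} {a} k∣a =
  subst (+ k ℤ.∣_) (sym (ℤ.+-identityʳ (+ a))) (ℤ.∣ᵤ⇒∣ k∣a)

-- The absorption identity, kept in product form so that no division occurs. With `suc n` prime, it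
-- exhibits that prime as a divisor of the left-hand product.
[1+k]*[1+n]C[1+k]≡[1+n]*nCk : ∀ n k → suc k * (suc n C suc k) ≡ suc n * (n C k)
[1+k]*[1+n]C[1+k]≡[1+n]*nCk zero zero = refl
[1+k]*[1+n]C[1+k]≡[1+n]*nCk zero (suc k) = begin
  suc (suc k) * (1 C suc (suc k)) ≡⟨ cong (suc (suc k) *_) (k>n⇒nCk≡0 (s<s (z<s {k}))) ⟩
  suc (suc k) * 0                 ≡⟨ *-zeroʳ (suc (suc k)) ⟩
  0                               ≡⟨ cong (1 *_) (k>n⇒nCk≡0 (z<s {k})) ⟨
  1 * (0 C suc k)                 ∎
  where open ≡-Reasoning
[1+k]*[1+n]C[1+k]≡[1+n]*nCk (suc n) zero = begin
  1 * (suc (suc n) C 1)                  ≡⟨ cong (1 *_) (nCk+nC[k+1]≡[n+1]C[k+1] (suc n) 0) ⟨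
  1 * (1 + (suc n C 1))                  ≡⟨ regroup (suc n C 1) ⟩
  1 + 1 * (suc n C 1)                    ≡⟨ cong suc ([1+k]*[1+n]C[1+k]≡[1+n]*nCk n 0) ⟩
  suc (suc n) * (suc n C 0)              ∎
  where
  open ≡-Reasoning
  regroup : ∀ x → 1 * (1 + x) ≡ 1 + 1 * x
  regroup = solve-∀
[1+k]*[1+n]C[1+k]≡[1+n]*nCk (suc n) (suc k) = begin
  suc (suc k) * (suc (suc n) C suc (suc k))
    ≡⟨ cong (suc (suc k) *_) (nCk+nC[k+1]≡[n+1]C[k+1] (suc n) (suc k)) ⟨
  suc (suc k) * (x + y)
    -- One copy of `x` is set aside so that the coefficients of `x` and `y` fit the two induction
    -- hypotheses. Their sum is `suc n * x` by Pascal's rule, and the spare `x` raises the factor to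
    -- `suc (suc n)`.
    ≡⟨ regroup (suc k) x y ⟩
  x + (suc k * x + suc (suc k) * y)
    ≡⟨ cong (x ℕ.+_) (cong₂ _+_ ([1+k]*[1+n]C[1+k]≡[1+n]*nCk n k)
                         ([1+k]*[1+n]C[1+k]≡[1+n]*nCk n (suc k))) ⟩
  x + (suc n * (n C k) + suc n * (n C suc k))
    ≡⟨ cong (x ℕ.+_) (factor (suc n) (n C k) (n C suc k)) ⟩
  x + suc n * (n C k + n C suc k)
    ≡⟨ cong (λ z → x + suc n * z) (nCk+nC[k+1]≡[n+1]C[k+1] n k) ⟩
  suc (suc n) * x ∎
  where
  open ≡-Reasoning
  x y : ℕ
  x = suc n C suc k
  y = suc n C suc (suc k)
  regroup : ∀ c x y → suc c * (x + y) ≡ x + (c * x + suc c * y)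
  regroup = solve-∀
  factor : ∀ c x y → c * x + c * y ≡ c * (x + y)
  factor = solve-∀

-- By absorption `p` divides `suc k * (p C suc k)`, and it cannot divide the positive factor `suc k`
-- below it, so Euclid's lemma leaves the coefficient.
p∣pC[1+k] : ∀ {p k} → Prime p → suc k < p → p ∣ p C suc k
p∣pC[1+k] {suc q} {k} pr 1+k<p
  with euclidsLemma (suc k) (suc q C suc k) pr
         (subst (suc q ∣_) (sym ([1+k]*[1+n]C[1+k]≡[1+n]*nCk q k)) (m∣m*n (q C k)))
... | inj₁ p∣1+k = contradiction p∣1+k (>⇒∤ 1+k<p)
... | inj₂ p∣C   = p∣C

-- In (1 + X)ᵃ(1 + Xᵖ) the term Xᵖ contributes nothing in degrees below `p`.
[a+p]Ck≡aCk : ∀ {p} → Prime p → ∀ a k → k < p → + ((a + p) C k) ≡ + (a C k) [mod + p ]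
[a+p]Ck≡aCk {p} pr a zero k<p = ≡⇒≡-mod {1} (+ p) refl
[a+p]Ck≡aCk {p} pr zero (suc k) k<p =
  subst (λ z → + (p C suc k) ≡ + z [mod + p ]) (sym (k>n⇒nCk≡0 (z<s {k})))
    (∣⇒≡0-mod (p∣pC[1+k] pr k<p))
[a+p]Ck≡aCk {p} pr (suc a) (suc k) k<p =
  subst₂ (λ x y → + x ≡ + y [mod + p ])
    (nCk+nC[k+1]≡[n+1]C[k+1] (a + p) k) (nCk+nC[k+1]≡[n+1]C[k+1] a k)
    (+-cong-mod ((a + p) C k) (a C k) ((a + p) C suc k) (a C suc k)
      -- Here `k<p` bounds `suc k`; since `k < p` unfolds to `suc k ≤ p`, weakening it gives the
      -- bound on `k`.
      ([a+p]Ck≡aCk pr a k (<⇒≤ k<p)) ([a+p]Ck≡aCk pr a (suc k) k<p))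

[a+p]C[k+p]≡aCk+aC[k+p] : ∀ {p} → Prime p → ∀ a k →
  + ((a + p) C (k + p)) ≡ + (a C k + a C (k + p)) [mod + p ]
[a+p]C[k+p]≡aCk+aC[k+p] {zero} pr = contradiction pr ¬prime[0]
[a+p]C[k+p]≡aCk+aC[k+p] {p@(suc _)} pr zero zero =
  ≡⇒≡-mod (+ p) (trans (nCn≡1 p) (cong suc (sym (k>n⇒nCk≡0 {0} {p} z<s))))
[a+p]C[k+p]≡aCk+aC[k+p] {p@(suc _)} pr zero (suc k) =
  ≡⇒≡-mod (+ p) (trans (k>n⇒nCk≡0 (m<n+m p (z<s {k})))
    (sym (cong₂ _+_ (k>n⇒nCk≡0 (z<s {k})) (k>n⇒nCk≡0 (z<s {k + p})))))
-- Pascal's rule reaches down to the index `q`, just below `p`, where the induction hypothesis says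
-- nothing; the congruence in low degrees takes over.
[a+p]C[k+p]≡aCk+aC[k+p] {p@(suc q)} pr (suc a) zero =
  subst₂ (λ x y → + x ≡ + y [mod + p ])
    (nCk+nC[k+1]≡[n+1]C[k+1] (a + p) q)
    (trans (swap (a C q) (a C p)) (cong suc (nCk+nC[k+1]≡[n+1]C[k+1] a q)))
    (+-cong-mod ((a + p) C q) (a C q) ((a + p) C p) (1 + a C p)
      ([a+p]Ck≡aCk pr a q (n<1+n q)) ([a+p]C[k+p]≡aCk+aC[k+p] pr a zero))
  where
  swap : ∀ x y → x + (1 + y) ≡ 1 + (x + y)
  swap = solve-∀
[a+p]C[k+p]≡aCk+aC[k+p] {p@(suc _)} pr (suc a) (suc k) =
  subst₂ (λ x y → + x ≡ + y [mod + p ])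
    (nCk+nC[k+1]≡[n+1]C[k+1] (a + p) (k + p))
    (trans (interchange (a C k) (a C (k + p)) (a C suc k) (a C suc (k + p)))
      (cong₂ _+_ (nCk+nC[k+1]≡[n+1]C[k+1] a k) (nCk+nC[k+1]≡[n+1]C[k+1] a (k + p))))
    (+-cong-mod ((a + p) C (k + p)) (a C k + a C (k + p))
      ((a + p) C suc (k + p)) (a C suc k + a C suc (k + p))
      ([a+p]C[k+p]≡aCk+aC[k+p] pr a k) ([a+p]C[k+p]≡aCk+aC[k+p] pr a (suc k)))
  where
  interchange : ∀ w x y z → (w + x) + (y + z) ≡ (w + y) + (x + z)
  interchange = solve-∀

-- Ranging over all `n` and `m` keeps the induction closed: Pascal's rule also calls on the pair
-- `n`, `suc m`, whose lower index may exceed the upper.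
[n*p]C[m*p]≡nCm : ∀ {p} → Prime p → ∀ n m → + ((n * p) C (m * p)) ≡ + (n C m) [mod + p ]
[n*p]C[m*p]≡nCm {zero} pr = contradiction pr ¬prime[0]
[n*p]C[m*p]≡nCm {p@(suc _)} pr n zero = ≡⇒≡-mod {1} (+ p) refl
[n*p]C[m*p]≡nCm {p@(suc q)} pr zero (suc m) =
  ≡⇒≡-mod (+ p) (trans (k>n⇒nCk≡0 (z<s {q + m * p})) (sym (k>n⇒nCk≡0 (z<s {m}))))
[n*p]C[m*p]≡nCm {p@(suc _)} pr (suc n) (suc m) =
  subst₂ (λ x y → + x ≡ + y [mod + p ])
    -- `suc n * p` unfolds to `p + n * p`, whereas the recurrence adds `p` on the right.
    (cong₂ _C_ (+-comm (n * p) p) (+-comm (m * p) p))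
    (nCk+nC[k+1]≡[n+1]C[k+1] n m)
    (≡-mod-trans (+ ((n * p + p) C (m * p + p)))
      (+ ((n * p) C (m * p) + (n * p) C (m * p + p)))
      (+ (n C m + n C suc m))
      ([a+p]C[k+p]≡aCk+aC[k+p] pr (n * p) (m * p))
      (+-cong-mod ((n * p) C (m * p)) (n C m) ((n * p) C (m * p + p)) (n C suc m)
        ([n*p]C[m*p]≡nCm pr n m)
        (subst (λ z → + ((n * p) C z) ≡ + (n C suc m) [mod + p ]) (+-comm p (m * p))
          ([n*p]C[m*p]≡nCm pr n (suc m)))))

corollary4 : ∀ (n m : ℕ) → 1 ≤ n → 1 ≤ m → m ≤ n →
    ∀ (p : ℕ) → Prime p →
    + ((n * p) C (m * p)) ≡ + (n C m) [mod + p ]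
corollary4 n m _ _ _ p pr = [n*p]C[m*p]≡nCm pr n m
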